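{- For every $n\ge 1$ the genus distribution of the closed-end ladder $L_n$ is log-concave, and its peak $p_L(n)$ satisfies $$p_L(n)=\Big[\frac{n+2}{3}\Big]\quad\text{if } n\ge 2.$$
   Context: $[x]$ denotes the largest integer not exceeding $x$. The closed-end ladder $L_n$ is the cubic multigraph with vertices $u_1,\dots,u_n,v_1,\dots,v_n$ and edges $u_lu_{l+1}$, $v_lv_{l+1}$ ($1\le l\le n-1$), the rungs $u_lv_l$ ($1\le l\le n$), and in addition one extra edge joining $u_1$ and $v_1$ and one extra edge joining $u_n$ and $v_n$ (closing the two ends; for $n=1$ there are three parallel edges). For a graph $G$, $g_i(G)$ is the number of 2-cell embeddings of $G$ on the orientable surface of genus $i$ (embeddings counted as rotation systems), and the genus distribution of $G$ is the sequence $g_\gamma(G),g_{\gamma+1}(G),\dots,g_{\gamma_M}(G)$ with $\gamma,\gamma_M$ the minimum and maximum genus of $G$. A finite sequence of nonnegative numbers is log-concave if $a_i^2\ge a_{i-1}a_{i+1}$ for all interior indices $i$. It is unimodal if $a_q\le\cdots\le a_{l-1}<a_l=\cdots=a_m>a_{m+1}\ge\cdots\ge a_n$ for some $q\le l\le m\le n$; if $l=m$, then $m$ is called the peak (indices are genera). -}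

module Defs where

open import Data.Bool.Base using (Bool; true; false; not)
open import Data.Fin.Base using (Fin; zero; suc; inject₁; fromℕ)
open import Data.Fin.Properties using (*↔×; +↔⊎; 2↔Bool)
open import Data.Nat.Base using (ℕ; suc; _+_; _*_; _≤_; _<_; NonZero)
open import Data.Product.Base using (∃; ∃-syntax; _×_; _,_; proj₁; proj₂)
open import Data.Product.Function.NonDependent.Propositional using (_×-↔_)
open import Data.Sum.Base using (_⊎_; inj₁; inj₂)
open import Data.Sum.Function.Propositional using (_⊎-↔_)
open import Function.Base using (_∘_)
open import Function.Bundles using (_↔_; _⇔_; Inverse; mk↔ₛ′)
open import Function.Construct.Composition using (_↔-∘_)
open import Function.Construct.Identity using (↔-id)
open import Function.Construct.Symmetry using (↔-sym)
open import Level using (0ℓ)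
open import Relation.Binary.Bundles using (Setoid)
open import Relation.Binary.PropositionalEquality
  using (_≡_; refl; setoid; _→-setoid_)
import Relation.Binary.Construct.Closure.Equivalence as Eq
import Relation.Binary.Construct.On as On

------------------------------------------------------------------------
-- Cardinality and orbits

-- The quotient of S by its equality has exactly k elements.
HasCard : Setoid 0ℓ 0ℓ → ℕ → Set
HasCard S k = Inverse S (setoid (Fin k))

-- For a permutation f the equivalence classes are the cycles of f,
-- fixed points included.
Orbits : {A : Set} → (A → A) → Setoid 0ℓ 0ℓ
Orbits f = Eq.setoid (λ x y → f x ≡ y)

SameOrbit : {A : Set} → (A → A) → A → A → Set
SameOrbit f = Setoid._≈_ (Orbits f)

------------------------------------------------------------------------
-- Finite multigraphs

-- Parallel edges and loops are allowed.  The order of the two ends of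
-- an edge only serves to name its two darts.
record Multigraph : Set₁ where
  field
    Vertex      : Set
    Edge        : Set
    ends        : Edge → Vertex × Vertex
    #vertices   : ℕ
    #edges      : ℕ
    vertex-card : HasCard (setoid Vertex) #vertices
    edge-card   : HasCard (setoid Edge) #edges

  Dart : Set
  Dart = Edge × Bool

  origin : Dart → Vertex
  origin (e , false) = proj₁ (ends e)
  origin (e , true)  = proj₂ (ends e)

  opposite : Dart → Dart
  opposite (e , b) = e , not b

------------------------------------------------------------------------
-- Rotation systems and genus

-- A cyclic ordering of the darts at each vertex: a permutation of the
-- darts having exactly one cycle on the darts at every vertex.
record RotationSystem (G : Multigraph) : Set where
  open Multigraph G
  field
    rotation : Dart ↔ Dart
    cyclic   : ∀ d d′ → origin d ≡ origin d′ ⇔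
                        SameOrbit (Inverse.to rotation) d d′

  next : Dart → Dart
  next = Inverse.to rotation

  -- The faces are the cycles of: cross the edge, then rotate.
  Faces : Setoid 0ℓ 0ℓ
  Faces = Orbits (next ∘ opposite)

-- Euler's formula V - E + F = 2 - 2 i, with the negative terms moved
-- across.  It gives the genus of the surface when G is connected and
-- has at least one edge.
HasGenus : {G : Multigraph} → RotationSystem G → ℕ → Set
HasGenus {G} ρ i =
  ∃[ F ] HasCard (RotationSystem.Faces ρ) F ×
         #vertices + F + 2 * i ≡ #edges + 2
  where open Multigraph G

Embedding : Multigraph → ℕ → Set
Embedding G i = ∃ λ (ρ : RotationSystem G) → HasGenus ρ i

-- Rotation systems are identified when their permutations agree
-- pointwise; the attached proofs play no role.
Embeddings : Multigraph → ℕ → Setoid 0ℓ 0ℓ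
Embeddings G i = On.setoid {B = Embedding G i} (Dart →-setoid Dart)
                           (RotationSystem.next ∘ proj₁)
  where open Multigraph G

-- All data in this record are uniquely determined by G.
record GenusDistribution (G : Multigraph) : Set where
  field
    g         : ℕ → ℕ
    g-card    : ∀ i → HasCard (Embeddings G i) (g i)
    γ         : ℕ
    γ-attains : Embedding G γ
    γ-minimum : ∀ i → Embedding G i → γ ≤ i
    γM         : ℕ
    γM-attains : Embedding G γM
    γM-maximum : ∀ i → Embedding G i → i ≤ γM

------------------------------------------------------------------------
-- Finite sequences a q , … , a r, given by a : ℕ → ℕ and the bounds

-- The interior indices are the 1 + i with q ≤ i and 2 + i ≤ r.
LogConcave : (a : ℕ → ℕ) (q r : ℕ) → Set
LogConcave a q r = ∀ i → q ≤ i → 2 + i ≤ r →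
                   a i * a (2 + i) ≤ a (1 + i) * a (1 + i)

-- a q ≤ … ≤ a (l-1) < a l = … = a m > a (m+1) ≥ … ≥ a r
record Unimodal (a : ℕ → ℕ) (q r l m : ℕ) : Set where
  field
    q≤l     : q ≤ l
    l≤m     : l ≤ m
    m≤r     : m ≤ r
    rising  : ∀ i → q ≤ i → suc i < l → a i ≤ a (suc i)
    jump    : ∀ i → q ≤ i → suc i ≡ l → a i < a l
    plateau : ∀ i → l ≤ i → i < m → a i ≡ a (suc i)
    drop    : suc m ≤ r → a (suc m) < a m
    falling : ∀ i → m < i → suc i ≤ r → a (suc i) ≤ a i

IsPeak : (a : ℕ → ℕ) (q r p : ℕ) → Set
IsPeak a q r p = Unimodal a q r p p

------------------------------------------------------------------------
-- Closed-end ladders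

data Side : Set where
  u v : Side

-- The edges of the ladder with suc k rungs.
data LadderEdge (k : ℕ) : Set where
  rail     : Side → Fin k → LadderEdge k
  rung     : Fin (suc k) → LadderEdge k
  leftEnd  : LadderEdge k
  rightEnd : LadderEdge k

private
  Side↔Fin2 : Side ↔ Fin 2
  Side↔Fin2 = mk↔ₛ′
    (λ { u → zero ; v → suc zero })
    (λ { zero → u ; (suc zero) → v })
    (λ { zero → refl ; (suc zero) → refl })
    (λ { u → refl ; v → refl })

  LadderVertex↔Fin : ∀ n → (Fin n × Side) ↔ Fin (n * 2)
  LadderVertex↔Fin n = ↔-sym *↔× ↔-∘ (↔-id (Fin n) ×-↔ Side↔Fin2)

  LadderEdge↔sum : ∀ k → LadderEdge k ↔
                         (((Side × Fin k) ⊎ Fin (suc k)) ⊎ Bool)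
  LadderEdge↔sum k = mk↔ₛ′
    (λ { (rail s l) → inj₁ (inj₁ (s , l))
       ; (rung l)   → inj₁ (inj₂ l)
       ; leftEnd    → inj₂ false
       ; rightEnd   → inj₂ true })
    (λ { (inj₁ (inj₁ (s , l))) → rail s l
       ; (inj₁ (inj₂ l))       → rung l
       ; (inj₂ false)          → leftEnd
       ; (inj₂ true)           → rightEnd })
    (λ { (inj₁ (inj₁ (s , l))) → refl
       ; (inj₁ (inj₂ l))       → refl
       ; (inj₂ false)          → refl
       ; (inj₂ true)           → refl })
    (λ { (rail s l) → refl
       ; (rung l)   → refl
       ; leftEnd    → refl
       ; rightEnd   → refl })

  LadderEdge↔Fin : ∀ k → LadderEdge k ↔ Fin (2 * k + suc k + 2)
  LadderEdge↔Fin k =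
    (↔-sym +↔⊎ ↔-∘
      ((↔-sym +↔⊎ ↔-∘
        ((↔-sym *↔× ↔-∘ (Side↔Fin2 ×-↔ ↔-id (Fin k))) ⊎-↔ ↔-id (Fin (suc k))))
       ⊎-↔ ↔-sym 2↔Bool))
    ↔-∘ LadderEdge↔sum k

-- Vertices are indexed from 0: (l , u) is u_{l+1} and (l , v) is
-- v_{l+1}; for one rung, leftEnd, rightEnd and the rung are parallel.
closedEndLadder : (n : ℕ) .{{_ : NonZero n}} → Multigraph
closedEndLadder (suc k) = record
  { Vertex      = Fin (suc k) × Side
  ; Edge        = LadderEdge k
  ; ends        = λ { (rail s l) → (inject₁ l , s) , (suc l , s)
                    ; (rung l)   → (l , u) , (l , v)
                    ; leftEnd    → (zero , u) , (zero , v)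
                    ; rightEnd   → (fromℕ k , u) , (fromℕ k , v) }
  ; #vertices   = suc k * 2
  ; #edges      = 2 * k + suc k + 2
  ; vertex-card = LadderVertex↔Fin (suc k)
  ; edge-card   = LadderEdge↔Fin k
  }

{-# OPTIONS --safe #-}

-- Peel the ladder from the left, one rung at a time.  For face tracing
-- the part to the left of a cut through the two rails is only a way of
-- linking two strands, crossed or straight.  The four choices of
-- rotations at the two ends of a rung send crossed to straight twice and
-- to crossed twice, completing a face in the latter case, and send
-- straight to crossed.  Counting the rotations by genus with this
-- two-state automaton gives g_i(L_{n+2}) = 2 g_i(L_{n+1}) + 8 g_{i-1}(L_n),
-- and hence, with n + 1 = 2 i + d,
--   g_i(L_n) = 2 ^ (3 i + d - 2) (i + 2 d) (i + d - 1)! / (i! d!).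
-- The ratio of consecutive entries is decreasing in i, and exceeds 1
-- exactly when 3 (i + 1) ≤ n + 2, for n ≥ 2.
module Submission where

open import Defs
open import Data.Nat using (ℕ; _+_; _≤_; _/_; NonZero)
open import Data.Product using (_×_)

open import Data.Bool.Base using (Bool; true; false)
open import Data.Fin.Base using (Fin; zero; suc; inject₁; fromℕ; fromℕ<)
open import Data.Fin.Induction using (>-weakInduction)
open import Data.Fin.Permutation using (↔⇒≡)
open import Data.Fin.Properties using (+↔⊎)
open import Data.Fin.Relation.Unary.Top using (View; view; ‵fromℕ; ‵inject₁; view-fromℕ; view-inject₁)
open import Data.Nat.Base using (zero; suc; _*_; _^_; _%_; _!; _<_; z≤n; s≤s; >-nonZero)
open import Data.Nat.DivMod using (m/n*n≤m; m*n/n≡m; /-monoˡ-≤; m≡m%n+[m/n]*n; m%n<n)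
open import Data.Nat.GeneralisedArithmetic using (iterate)
open import Data.Nat.Properties
open import Data.Nat.Tactic.RingSolver using (solve-∀)
open import Data.Product.Base using (∃-syntax; Σ-syntax; _,_; proj₁; proj₂; swap)
open import Data.Sum.Base using (_⊎_; inj₁; inj₂; [_,_]′)
open import Data.Sum.Function.Propositional using (_⊎-↔_)
open import Data.Sum.Function.Setoid using (_⊎-inverse_)
open import Data.Sum.Relation.Binary.Pointwise using (_⊎ₛ_; inj₁; inj₂; Pointwise-≡↔≡)
open import Data.Vec.Base using (Vec; []; _∷_; lookup; tabulate)
open import Data.Vec.Properties using (tabulate-cong; tabulate∘lookup; lookup∘tabulate)
open import Function.Base using (id; _∘_)
open import Function.Bundles using (Inverse; _↔_; mk↔ₛ′; mk⇔; Equivalence)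
open import Function.Consequences.Setoid using (strictlyInverseˡ⇒inverseˡ; strictlyInverseʳ⇒inverseʳ)
open import Function.Construct.Composition using (_↔-∘_)
open import Function.Construct.Symmetry using (↔-sym)
open import Function.Definitions using (Injective)
open import Level using (0ℓ)
open import Relation.Binary.Bundles using (Setoid)
open import Relation.Binary.Construct.Closure.ReflexiveTransitive using (ε; _◅_)
open import Relation.Binary.Construct.Closure.Symmetric using (fwd)
open import Relation.Binary.PropositionalEquality
open import Relation.Binary.Structures using (IsEquivalence)
open import Relation.Nullary using (yes; no; contradiction)
import Function.Construct.Composition as Compose
import Function.Construct.Identity as Identity
import Function.Construct.Symmetry as Symmetry
import Relation.Binary.Construct.Closure.Equivalence as Eq

-- The obstacle is that peeling a rung changes the set of darts, so the faces before and after
-- cannot be compared by restricting a permutation. `Open` therefore records face tracing to the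
-- right of a cut as a partial permutation that may run out through the cut, and `closeUp` supplies
-- whatever lies to the left. A rail dart directed to the right is represented by its successor;
-- this makes the effect of a rung a computation that never looks into the rest of the ladder. There
-- are only two linkages because a strand entering the left part on one of two sides comes back on
-- one of two sides, bijectively. The edge `leftEnd` joins the two sides and so starts the automaton
-- in `crossed`. A cubic vertex has exactly two rotations, so a rotation system is a vector of pairs
-- of booleans. Genus enters only through Euler's formula, by counting faces.

-- Orbits and their cardinality.

module _ {A : Set} {f : A → A} where

  along : ∀ n {x} → SameOrbit f x (iterate f x n)
  along zero    = ε
  along (suc n) = fwd refl ◅ along n

  -- The orbit relation is generated by single applications of `f`, so a map out of it is checked on
  -- one application only. The two maps need not be bijections of points, which is what allows faces
  -- with different sets of darts to be matched.
  orbitsInverse :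
    (T : Setoid 0ℓ 0ℓ) → let open Setoid T using (Carrier; _≈_) in
    (to : A → Carrier) (from : Carrier → A) →
    (∀ x → to (f x) ≈ to x) →
    (∀ {y z} → y ≈ z → SameOrbit f (from y) (from z)) →
    (∀ y → to (from y) ≈ y) →
    (∀ x → SameOrbit f (from (to x)) x) →
    Inverse (Orbits f) T
  orbitsInverse T to from to-f from-cong to-from from-to = record
    { to        = to
    ; from      = from
    ; to-cong   = to-cong
    ; from-cong = from-cong
    ; inverse   = strictlyInverseˡ⇒inverseˡ (Orbits f) T to-cong to-from
                , strictlyInverseʳ⇒inverseʳ (Orbits f) T from-cong from-to
    }
    where
    to-cong : ∀ {x y} → SameOrbit f x y → Setoid._≈_ T (to x) (to y)
    to-cong = Eq.gfold (Setoid.isEquivalence T) to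
                       (λ { refl → Setoid.sym T (to-f _) })

  sameOrbit-map : {B : Set} {g : B → B} (h : B → A) →
    (∀ y → SameOrbit f (h y) (h (g y))) →
    ∀ {y z} → SameOrbit g y z → SameOrbit f (h y) (h z)
  sameOrbit-map h h-g = Eq.gfold (Setoid.isEquivalence (Orbits f)) h
                                 (λ { refl → h-g _ })

HasCard-⊎ : ∀ {S T m n} → HasCard S m → HasCard T n → HasCard (S ⊎ₛ T) (m + n)
HasCard-⊎ p q =
  Compose.inverse (p ⊎-inverse q)
    (Compose.inverse (Pointwise-≡↔≡ _ _) (↔-sym +↔⊎))

-- Face tracing in a ladder cut open on the left.

flip : Side → Side
flip u = v
flip v = u

-- How the part of the ladder to the left of a cut joins the two strands
-- running through the cut: a strand entering it on side s comes back on
-- the other side or on side s itself.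
data Linkage : Set where
  crossed straight : Linkage

twist : Linkage → Side → Side
twist crossed  s = flip s
twist straight s = s

-- Face tracing to the right of a cut: enter s is the first dart after
-- crossing the cut rightwards on side s, and step y = inj₂ s says that
-- the face of y crosses the cut leftwards on side s.
record Open : Set₁ where
  field
    Carrier : Set
    enter   : Side → Carrier
    step    : Carrier → Carrier ⊎ Side

closeUp : Linkage → (S : Open) → Open.Carrier S → Open.Carrier S
closeUp ℓ S y = [ id , Open.enter S ∘ twist ℓ ]′ (Open.step S y)

-- The three darts at a vertex, named by the direction in which they
-- leave; leftEnd leaves to the left and rightEnd to the right.
data Slot : Set where
  left across right : Slot

turn : Bool → Slot → Slot
turn true  left   = across
turn true  across = right
turn true  right  = left
turn false left   = right
turn false across = left
turn false right  = across

Rung : Set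
Rung = Bool × Bool

orientation : Rung → Side → Bool
orientation (a , _) u = a
orientation (_ , b) v = b

-- The darts leaving a rung to the right along a rail are left out: an
-- open ladder represents each of them by the dart following it.
data RungDart : Set where
  back over : Side → RungDart

depart : (S : Open) → Side → Slot → RungDart ⊎ Open.Carrier S
depart S s left   = inj₁ (back s)
depart S s across = inj₁ (over s)
depart S s right  = inj₂ (Open.enter S s)

arrive : Rung → (S : Open) → Side → Slot → RungDart ⊎ Open.Carrier S
arrive r S s x = depart S s (turn (orientation r s) x)

addRung : Rung → Open → Open
addRung r S = record
  { Carrier = RungDart ⊎ Carrier
  ; enter   = λ s → arrive r S s left
  ; step    = λ { (inj₁ (back s)) → inj₂ s
                ; (inj₁ (over s)) → inj₁ (arrive r S (flip s) across)
                ; (inj₂ y)        → inj₁ ([ inj₂ , (λ s → arrive r S s right) ]′ (step y)) }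
  }
  where open Open S

-- What remains after the last rung: the two darts of the edge `rightEnd`, each named by the side
-- from which it starts and coming back on the other side.
rightEnds : Open
rightEnds = record { Carrier = Side ; enter = id ; step = inj₂ ∘ flip }

openLadder : ∀ {n} → Vec Rung n → Open
openLadder []       = rightEnds
openLadder (r ∷ rs) = addRung r (openLadder rs)

-- The effect of one rung on the faces.

module _ (ℓ ℓ′ : Linkage) (r : Rung) (S : Open) where
  open Open S

  private
    f : RungDart ⊎ Carrier → RungDart ⊎ Carrier
    f = closeUp ℓ (addRung r S)

  -- A dart of the new rung gets out to the open ladder, or back to the
  -- chosen dart rep i of a face closed by the rung, in the number of steps
  -- given by trace.
  HasCard-addRung : ∀ {δ F} (trace : RungDart → ℕ × (Fin δ ⊎ Side)) (rep : Fin δ → RungDart) →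
    let T : RungDart ⊎ Carrier → Fin δ ⊎ Carrier
        T = [ [ inj₁ , inj₂ ∘ enter ]′ ∘ proj₂ ∘ trace , inj₂ ]′
    in
    (∀ s → T (arrive r S s right) ≡ inj₂ (enter (twist ℓ′ s))) →
    (∀ e → T (f (inj₁ e)) ≡ T (inj₁ e)) →
    (∀ e → iterate f (inj₁ e) (proj₁ (trace e)) ≡ [ inj₁ ∘ rep , inj₂ ]′ (T (inj₁ e))) →
    (∀ i → T (inj₁ (rep i)) ≡ inj₁ i) →
    HasCard (Orbits (closeUp ℓ′ S)) F → HasCard (Orbits f) (δ + F)
  HasCard-addRung {δ} trace rep T-right T-f meets T-rep card =
    Compose.inverse
      (orbitsInverse (setoid (Fin δ) ⊎ₛ Orbits g) T R T∘f R-cong T∘R R∘T)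
      (HasCard-⊎ (Identity.inverse (setoid (Fin δ))) card)
    where
    g : Carrier → Carrier
    g = closeUp ℓ′ S

    T : RungDart ⊎ Carrier → Fin δ ⊎ Carrier
    T = [ [ inj₁ , inj₂ ∘ enter ]′ ∘ proj₂ ∘ trace , inj₂ ]′

    R : Fin δ ⊎ Carrier → RungDart ⊎ Carrier
    R = [ inj₁ ∘ rep , inj₂ ]′

    open Setoid (setoid (Fin δ) ⊎ₛ Orbits g) using (_≈_) renaming (reflexive to ≈-reflexive)
    open Setoid (Orbits f) using () renaming (sym to ∼-sym; trans to ∼-trans)

    T∘f : ∀ x → T (f x) ≈ T x
    T∘f (inj₁ e) = ≈-reflexive (T-f e)
    -- An inner dart either moves as it does under `g` or leaves the inner ladder and passes through
    -- the rung; by `T-right` that detour leads back in exactly where the linkage `ℓ′` sends it.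
    T∘f (inj₂ y) with step y in eq
    ... | inj₁ z = inj₂ (Setoid.sym (Orbits g) (Eq.return (cong [ id , enter ∘ twist ℓ′ ]′ eq)))
    ... | inj₂ s = subst (_≈ inj₂ y) (sym (T-right s))
                     (inj₂ (Setoid.sym (Orbits g) (Eq.return (cong [ id , enter ∘ twist ℓ′ ]′ eq))))

    R∘T : ∀ x → SameOrbit f (R (T x)) x
    R∘T (inj₁ e) = ∼-sym (subst (SameOrbit f (inj₁ e)) (meets e) (along (proj₁ (trace e))))
    R∘T (inj₂ y) = ε

    R-g : ∀ y → SameOrbit f (inj₂ y) (inj₂ (g y))
    R-g y with step y in eq
    ... | inj₁ z = Eq.return (cong [ inj₂ , (λ s → arrive r S s right) ]′ eq)
    ... | inj₂ s = ∼-trans (Eq.return (cong [ inj₂ , (λ s → arrive r S s right) ]′ eq))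
                     (subst (λ t → SameOrbit f (arrive r S s right) (R t)) (T-right s)
                            (∼-sym (R∘T (arrive r S s right))))

    R-cong : ∀ {x y} → x ≈ y → SameOrbit f (R x) (R y)
    R-cong (inj₁ refl) = ε
    R-cong (inj₂ p)    = sameOrbit-map inj₂ R-g p

    T∘R : ∀ x → T (R x) ≈ x
    T∘R (inj₁ i) = ≈-reflexive (T-rep i)
    T∘R (inj₂ y) = inj₂ ε

-- The slot `across` points towards v at u and towards u at v, so two rotations of the same sense in
-- a planar drawing carry opposite booleans. The mixed choices are the planar ones; they keep
-- `crossed` and close the face to the left of the rung.
advance : Linkage → Rung → Linkage
advance crossed  (true  , true)  = straight
advance crossed  (true  , false) = crossed
advance crossed  (false , true)  = crossed
advance crossed  (false , false) = straight
advance straight r               = crossed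

closedFaces : Linkage → Rung → ℕ
closedFaces crossed  (true  , true)  = 0
closedFaces crossed  (true  , false) = 1
closedFaces crossed  (false , true)  = 1
closedFaces crossed  (false , false) = 0
closedFaces straight r               = 0

endFaces : Linkage → ℕ
endFaces crossed  = 2
endFaces straight = 1

faces : ∀ {n} → Linkage → Vec Rung n → ℕ
faces ℓ []       = endFaces ℓ
faces ℓ (r ∷ rs) = closedFaces ℓ r + faces (advance ℓ r) rs

private
  sides : {P : Side → Set} → P u → P v → ∀ s → P s
  sides pu pv u = pu
  sides pu pv v = pv

  darts : {P : RungDart → Set} →
          P (back u) → P (back v) → P (over u) → P (over v) → ∀ e → P e
  darts bu bv ou ov (back u) = bu
  darts bu bv ou ov (back v) = bv
  darts bu bv ou ov (over u) = ou
  darts bu bv ou ov (over v) = ov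

-- The tables come from following each dart of the rung until it enters the inner ladder or reaches
-- the chosen dart of a closed face. No trace takes a step inside `S`, so for concrete `ℓ` and `r`
-- all conditions hold by computation.
HasCard-rung : ∀ ℓ r (S : Open) {F} →
  HasCard (Orbits (closeUp (advance ℓ r) S)) F →
  HasCard (Orbits (closeUp ℓ (addRung r S))) (closedFaces ℓ r + F)
HasCard-rung crossed (true , true) S =
  HasCard-addRung crossed straight _ S
    (darts (2 , inj₂ u) (2 , inj₂ v) (1 , inj₂ v) (1 , inj₂ u)) (λ ())
    (sides refl refl) (darts refl refl refl refl) (darts refl refl refl refl) (λ ())
HasCard-rung crossed (false , false) S =
  HasCard-addRung crossed straight _ S
    (darts (1 , inj₂ v) (1 , inj₂ u) (2 , inj₂ u) (2 , inj₂ v)) (λ ())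
    (sides refl refl) (darts refl refl refl refl) (darts refl refl refl refl) (λ ())
HasCard-rung crossed (true , false) S =
  HasCard-addRung crossed crossed _ S
    -- The face closed here consists of `back v` and `over u`; the former is its representative and
    -- hence has a trace of length 0.
    (darts (1 , inj₂ v) (0 , inj₁ zero) (1 , inj₁ zero) (1 , inj₂ u)) (λ _ → back v)
    (sides refl refl) (darts refl refl refl refl) (darts refl refl refl refl) (λ { zero → refl })
HasCard-rung crossed (false , true) S =
  HasCard-addRung crossed crossed _ S
    (darts (0 , inj₁ zero) (1 , inj₂ u) (1 , inj₂ v) (1 , inj₁ zero)) (λ _ → back u)
    (sides refl refl) (darts refl refl refl refl) (darts refl refl refl refl) (λ { zero → refl })
HasCard-rung straight (true , true) S =
  HasCard-addRung straight crossed _ S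
    (darts (2 , inj₂ v) (2 , inj₂ u) (1 , inj₂ v) (1 , inj₂ u)) (λ ())
    (sides refl refl) (darts refl refl refl refl) (darts refl refl refl refl) (λ ())
HasCard-rung straight (false , false) S =
  HasCard-addRung straight crossed _ S
    (darts (1 , inj₂ u) (1 , inj₂ v) (2 , inj₂ v) (2 , inj₂ u)) (λ ())
    (sides refl refl) (darts refl refl refl refl) (darts refl refl refl refl) (λ ())
HasCard-rung straight (true , false) S =
  HasCard-addRung straight crossed _ S
    (darts (3 , inj₂ v) (1 , inj₂ v) (2 , inj₂ v) (1 , inj₂ u)) (λ ())
    (sides refl refl) (darts refl refl refl refl) (darts refl refl refl refl) (λ ())
HasCard-rung straight (false , true) S =
  HasCard-addRung straight crossed _ S
    (darts (1 , inj₂ u) (3 , inj₂ u) (1 , inj₂ v) (2 , inj₂ u)) (λ ())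
    (sides refl refl) (darts refl refl refl refl) (darts refl refl refl refl) (λ ())

HasCard-faces : ∀ {n} ℓ (rs : Vec Rung n) →
  HasCard (Orbits (closeUp ℓ (openLadder rs))) (faces ℓ rs)
HasCard-faces crossed [] =
  orbitsInverse (setoid (Fin 2)) (sides zero (suc zero)) (λ { zero → u ; (suc zero) → v })
    (sides refl refl) (λ { refl → ε }) (λ { zero → refl ; (suc zero) → refl }) (sides ε ε)
HasCard-faces straight [] =
  orbitsInverse (setoid (Fin 1)) (λ _ → zero) (λ _ → u)
    (λ _ → refl) (λ _ → ε) (λ { zero → refl }) (sides ε (along 1))
HasCard-faces ℓ (r ∷ rs) = HasCard-rung ℓ r _ (HasCard-faces (advance ℓ r) rs)

-- Matching the faces of the ladder with those of the open ladder.

Corner : ℕ → Set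
Corner n = (Fin n × Side) × Slot

sucᶜ : ∀ {n} → Corner n → Corner (suc n)
sucᶜ ((l , s) , x) = (suc l , s) , x

orientationAt : ∀ {n} → Vec Rung n → Fin n × Side → Bool
orientationAt rs (l , s) = orientation (lookup rs l) s

rotate : ∀ {n} → Vec Rung n → Corner n → Corner n
rotate rs (w , x) = w , turn (orientationAt rs w) x

toOpen : ∀ {n} (rs : Vec Rung n) → Corner n → Open.Carrier (openLadder rs)
toOpen (r ∷ rs) ((zero  , s) , x) = depart (openLadder rs) s x
toOpen (r ∷ rs) ((suc l , s) , x) = inj₂ (toOpen rs ((l , s) , x))

fromOpen : ∀ {k} (rs : Vec Rung (suc k)) → Open.Carrier (openLadder rs) → Corner (suc k)
fromOpen (r ∷ rs)      (inj₁ (back s)) = (zero , s) , left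
fromOpen (r ∷ rs)      (inj₁ (over s)) = (zero , s) , across
fromOpen (r ∷ [])      (inj₂ s)        = (zero , s) , right
fromOpen (r ∷ r′ ∷ rs) (inj₂ y)        = sucᶜ (fromOpen (r′ ∷ rs) y)

toOpen-fromOpen : ∀ {k} (rs : Vec Rung (suc k)) y → toOpen rs (fromOpen rs y) ≡ y
toOpen-fromOpen (r ∷ rs)      (inj₁ (back s)) = refl
toOpen-fromOpen (r ∷ rs)      (inj₁ (over s)) = refl
toOpen-fromOpen (r ∷ [])      (inj₂ s)        = refl
toOpen-fromOpen (r ∷ r′ ∷ rs) (inj₂ y)        = cong inj₂ (toOpen-fromOpen (r′ ∷ rs) y)

-- `fromOpen` recovers every corner except a `right` one with another rung after it, since `toOpen`
-- has merged that one with its successor.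
fromOpen-left : ∀ {k} (rs : Vec Rung (suc k)) l s →
  fromOpen rs (toOpen rs ((l , s) , left)) ≡ ((l , s) , left)
fromOpen-left (r ∷ rs)      zero    s = refl
fromOpen-left (r ∷ r′ ∷ rs) (suc l) s = cong sucᶜ (fromOpen-left (r′ ∷ rs) l s)

fromOpen-across : ∀ {k} (rs : Vec Rung (suc k)) l s →
  fromOpen rs (toOpen rs ((l , s) , across)) ≡ ((l , s) , across)
fromOpen-across (r ∷ rs)      zero    s = refl
fromOpen-across (r ∷ r′ ∷ rs) (suc l) s = cong sucᶜ (fromOpen-across (r′ ∷ rs) l s)

fromOpen-end : ∀ {k} (rs : Vec Rung (suc k)) s →
  fromOpen rs (toOpen rs ((fromℕ k , s) , right)) ≡ ((fromℕ k , s) , right)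
fromOpen-end (r ∷ [])      s = refl
fromOpen-end (r ∷ r′ ∷ rs) s = cong sucᶜ (fromOpen-end (r′ ∷ rs) s)

toOpen-rail : ∀ {k} (rs : Vec Rung (suc k)) l s →
  toOpen rs (rotate rs ((suc l , s) , left)) ≡ toOpen rs ((inject₁ l , s) , right)
toOpen-rail (r ∷ r′ ∷ rs) zero    s = refl
toOpen-rail (r ∷ r′ ∷ rs) (suc l) s = cong inj₂ (toOpen-rail (r′ ∷ rs) l s)

-- In use `c′` is the corner of the dart opposite to `c`, so that the open ladder steps as the face
-- permutation does. The left end is treated apart in `closeUp-leftEnd`, because there the step
-- leaves through the cut.
Follows : ∀ {n} → Vec Rung n → Corner n → Corner n → Set
Follows rs c c′ = Open.step (openLadder rs) (toOpen rs c) ≡ inj₁ (toOpen rs (rotate rs c′))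

follows-suc : ∀ {n} r (rs : Vec Rung n) c c′ → Follows rs c c′ → Follows (r ∷ rs) (sucᶜ c) (sucᶜ c′)
follows-suc r rs c c′ = cong (inj₁ ∘ [ inj₂ , (λ s → arrive r (openLadder rs) s right) ]′)

follows-rung : ∀ {k} (rs : Vec Rung k) l s → Follows rs ((l , s) , across) ((l , flip s) , across)
follows-rung (r ∷ rs) zero    s = refl
follows-rung (r ∷ rs) (suc l) s = follows-suc r rs _ ((l , flip s) , across) (follows-rung rs l s)

follows-rail : ∀ {k} (rs : Vec Rung (suc k)) l s → Follows rs ((suc l , s) , left) ((inject₁ l , s) , right)
follows-rail (r ∷ r′ ∷ rs) zero    s = refl
follows-rail (r ∷ r′ ∷ rs) (suc l) s =
  follows-suc r (r′ ∷ rs) ((suc l , s) , left) ((inject₁ l , s) , right) (follows-rail (r′ ∷ rs) l s)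

follows-end : ∀ {k} (rs : Vec Rung (suc k)) s → Follows rs ((fromℕ k , s) , right) ((fromℕ k , flip s) , right)
follows-end (r ∷ [])      s = refl
follows-end {suc k} (r ∷ r′ ∷ rs) s =
  follows-suc r (r′ ∷ rs) ((fromℕ k , s) , right) ((fromℕ k , flip s) , right) (follows-end (r′ ∷ rs) s)

closeUp-leftEnd : ∀ {k} (rs : Vec Rung (suc k)) s →
  closeUp crossed (openLadder rs) (toOpen rs ((zero , s) , left)) ≡
  toOpen rs (rotate rs ((zero , flip s) , left))
closeUp-leftEnd (r ∷ rs) s = refl

module Ladder (k : ℕ) where
  open Multigraph (closedEndLadder (suc k)) public using (Dart; opposite; origin)

  toCorner : Dart → Corner (suc k)
  toCorner d = origin d , slot d
    where
    slot : Dart → Slot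
    slot (rail s l , false) = right
    slot (rail s l , true)  = left
    slot (rung l   , _)     = across
    slot (leftEnd  , _)     = left
    slot (rightEnd , _)     = right

  endDart : Side → Bool
  endDart u = false
  endDart v = true

  exitDart : ∀ {l : Fin (suc k)} → View l → Side → Dart
  exitDart ‵fromℕ       s = rightEnd , endDart s
  exitDart (‵inject₁ l) s = rail s l , false

  dartAt : Slot → Fin (suc k) → Side → Dart
  dartAt left   zero    s = leftEnd , endDart s
  dartAt left   (suc l) s = rail s l , true
  dartAt across l       s = rung l , endDart s
  dartAt right  l       s = exitDart (view l) s

  fromCorner : Corner (suc k) → Dart
  fromCorner ((l , s) , x) = dartAt x l s

  fromCorner-fromℕ : ∀ s → fromCorner ((fromℕ k , s) , right) ≡ (rightEnd , endDart s)
  fromCorner-fromℕ s = cong (λ w → exitDart w s) (view-fromℕ k)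

  fromCorner-inject₁ : ∀ l s → fromCorner ((inject₁ l , s) , right) ≡ (rail s l , false)
  fromCorner-inject₁ l s = cong (λ w → exitDart w s) (view-inject₁ l)

  toCorner-fromCorner : ∀ c → toCorner (fromCorner c) ≡ c
  toCorner-fromCorner ((zero  , u) , left)   = refl
  toCorner-fromCorner ((zero  , v) , left)   = refl
  toCorner-fromCorner ((suc l , s) , left)   = refl
  toCorner-fromCorner ((l     , u) , across) = refl
  toCorner-fromCorner ((l     , v) , across) = refl
  toCorner-fromCorner ((l     , s) , right) with view l
  toCorner-fromCorner ((_     , u) , right) | ‵fromℕ     = refl
  toCorner-fromCorner ((_     , v) , right) | ‵fromℕ     = refl
  toCorner-fromCorner ((_     , s) , right) | ‵inject₁ i = refl

  fromCorner-toCorner : ∀ d → fromCorner (toCorner d) ≡ d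
  fromCorner-toCorner (rail s l , false) = fromCorner-inject₁ l s
  fromCorner-toCorner (rail s l , true)  = refl
  fromCorner-toCorner (rung l   , false) = refl
  fromCorner-toCorner (rung l   , true)  = refl
  fromCorner-toCorner (leftEnd  , false) = refl
  fromCorner-toCorner (leftEnd  , true)  = refl
  fromCorner-toCorner (rightEnd , false) = fromCorner-fromℕ u
  fromCorner-toCorner (rightEnd , true)  = fromCorner-fromℕ v

  module _ (rs : Vec Rung (suc k)) where

    rotateDart : Dart → Dart
    rotateDart = fromCorner ∘ rotate rs ∘ toCorner

    module _ (next : Dart → Dart) (next≗ : ∀ d → next d ≡ rotateDart d) where

      private
        f : Dart → Dart
        f = next ∘ opposite

        g : Open.Carrier (openLadder rs) → Open.Carrier (openLadder rs)
        g = closeUp crossed (openLadder rs)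

        open Setoid (Orbits f) using () renaming (sym to ∼-sym; trans to ∼-trans; reflexive to ∼-reflexive)

        T : Dart → Open.Carrier (openLadder rs)
        T = toOpen rs ∘ toCorner

        R : Open.Carrier (openLadder rs) → Dart
        R = fromCorner ∘ fromOpen rs

        T∘R : ∀ y → T (R y) ≡ y
        T∘R y = trans (cong (toOpen rs) (toCorner-fromCorner _)) (toOpen-fromOpen rs y)

        T∘f : ∀ d → T (f d) ≡ toOpen rs (rotate rs (toCorner (opposite d)))
        T∘f d = cong (toOpen rs) (trans (cong toCorner (next≗ (opposite d))) (toCorner-fromCorner _))

        closing : ∀ {y z} → Open.step (openLadder rs) y ≡ inj₁ z → g y ≡ z
        closing = cong [ id , _ ]′

        -- Singles out the darts that survive in the open ladder: it is shown for all but the rail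
        -- darts directed to the right.
        Stays : Dart → Set
        Stays d = g (T d) ≡ T (f d) × R (T d) ≡ d

        stays-rung : ∀ l b → Stays (rung l , b)
        stays-rung l false = trans (closing (follows-rung rs l u)) (sym (T∘f _))
                           , cong fromCorner (fromOpen-across rs l u)
        stays-rung l true  = trans (closing (follows-rung rs l v)) (sym (T∘f _))
                           , cong fromCorner (fromOpen-across rs l v)

        stays-rail : ∀ s l → Stays (rail s l , true)
        stays-rail s l = trans (closing (follows-rail rs l s)) (sym (T∘f _))
                       , cong fromCorner (fromOpen-left rs (suc l) s)

        stays-leftEnd : ∀ b → Stays (leftEnd , b)
        stays-leftEnd false = trans (closeUp-leftEnd rs u) (sym (T∘f _))
                            , cong fromCorner (fromOpen-left rs zero u)
        stays-leftEnd true  = trans (closeUp-leftEnd rs v) (sym (T∘f _))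
                            , cong fromCorner (fromOpen-left rs zero v)

        stays-rightEnd : ∀ b → Stays (rightEnd , b)
        stays-rightEnd false = trans (closing (follows-end rs u)) (sym (T∘f _))
                             , trans (cong fromCorner (fromOpen-end rs u)) (fromCorner-fromℕ u)
        stays-rightEnd true  = trans (closing (follows-end rs v)) (sym (T∘f _))
                             , trans (cong fromCorner (fromOpen-end rs v)) (fromCorner-fromℕ v)

        T-slide : ∀ s l → T (f (rail s l , false)) ≡ T (rail s l , false)
        T-slide s l = trans (T∘f (rail s l , false)) (toOpen-rail rs l s)

        -- T merges a rail dart directed to the right with its successor, so a
        -- property of all darts is carried back along the rails.
        module _ (P : Dart → Set) (base : ∀ {d} → Stays d → P d)
                 (slide : ∀ s l → P (f (rail s l , false)) → P (rail s l , false)) where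

          right-induction : ∀ l s → P (fromCorner ((l , s) , right))
          right-induction = >-weakInduction (λ l → ∀ s → P (fromCorner ((l , s) , right)))
            (λ s → subst P (sym (fromCorner-fromℕ s)) (base (stays-rightEnd _)))
            (λ l ih s → subst P (sym (fromCorner-inject₁ l s))
                          (slide s l (subst P (sym (next≗ (rail s l , true)))
                                       (rotated (orientationAt rs (suc l , s)) (ih s)))))
            where
            rotated : ∀ {l s} b → P (fromCorner ((suc l , s) , right)) → P (fromCorner ((suc l , s) , turn b left))
            rotated true  _ = base (stays-rung _ _)
            -- `turn false left` is `right`: the successor is again directed to the right, so the
            -- induction runs on towards `rightEnd`.
            rotated false p = p

          dart-induction : ∀ d → P d
          dart-induction (rail s l , false) = subst P (fromCorner-inject₁ l s) (right-induction (inject₁ l) s)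
          dart-induction (rail s l , true)  = base (stays-rail s l)
          dart-induction (rung l   , b)     = base (stays-rung l b)
          dart-induction (leftEnd  , b)     = base (stays-leftEnd b)
          dart-induction (rightEnd , b)     = base (stays-rightEnd b)

        R∘T : ∀ d → SameOrbit f (R (T d)) d
        R∘T = dart-induction _ (λ st → ∼-reflexive (proj₂ st))
          (λ s l p → ∼-trans (∼-reflexive (cong R (sym (T-slide s l)))) (∼-trans p (∼-sym (along 1))))

        -- Phrased for darts of the ladder so that `dart-induction` applies; `R-g` carries it over
        -- to the open ladder, `T` being onto.
        R∘g∘T : ∀ d → SameOrbit f (R (g (T d))) d
        R∘g∘T = dart-induction _
          (λ {d} st → ∼-trans (∼-reflexive (cong R (proj₁ st))) (∼-trans (R∘T (f d)) (∼-sym (along 1))))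
          (λ s l p → ∼-trans (∼-reflexive (cong (R ∘ g) (sym (T-slide s l)))) (∼-trans p (∼-sym (along 1))))

        T-orbit : ∀ d → SameOrbit g (T (f d)) (T d)
        T-orbit = dart-induction _
          (λ st → subst (λ y → SameOrbit g y _) (proj₁ st) (Setoid.sym (Orbits g) (along 1)))
          (λ s l _ → Setoid.reflexive (Orbits g) (T-slide s l))

        R-g : ∀ y → SameOrbit f (R y) (R (g y))
        R-g y = ∼-sym (subst (λ z → SameOrbit f (R (g z)) (R y)) (T∘R y) (R∘g∘T (R y)))

        facesInverse : Inverse (Orbits f) (Orbits g)
        facesInverse = orbitsInverse (Orbits g) T R T-orbit (sameOrbit-map R R-g)
          (λ y → Setoid.reflexive (Orbits g) (T∘R y)) R∘T

      HasCard-ladderFaces : HasCard (Orbits f) (faces crossed rs)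
      HasCard-ladderFaces = Compose.inverse facesInverse (HasCard-faces crossed rs)

HasCard-unique : ∀ {S m n} → HasCard S m → HasCard S n → m ≡ n
HasCard-unique p q = ↔⇒≡ (Compose.inverse (Symmetry.inverse p) q)

-- Rotation systems as vectors of orientations.

turn³ : ∀ b x → turn b (turn b (turn b x)) ≡ x
turn³ true  left   = refl
turn³ true  across = refl
turn³ true  right  = refl
turn³ false left   = refl
turn³ false across = refl
turn³ false right  = refl

turn-transitive : ∀ b x → SameOrbit (turn b) x left
turn-transitive b     left   = ε
turn-transitive true  across = along 2
turn-transitive true  right  = along 1
turn-transitive false across = along 1
turn-transitive false right  = along 2

turn-injective : ∀ b b′ → turn b left ≡ turn b′ left → b ≡ b′
turn-injective true  true  _ = refl
turn-injective false false _ = refl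

-- An injective map of three points without fixed points is one of the two 3-cycles.
derangement⇒turn : (p : Slot → Slot) → (∀ x → p x ≢ x) → Injective _≡_ _≡_ p →
                   ∃[ b ] ∀ x → p x ≡ turn b x
derangement⇒turn p p≢ inj with p left in pl | p across in pa | p right in pr
... | left   | _      | _      = contradiction pl (p≢ left)
... | _      | across | _      = contradiction pa (p≢ across)
... | _      | _      | right  = contradiction pr (p≢ right)
... | across | _      | across = contradiction (inj (trans pl (sym pr))) λ ()
... | right  | right  | _      = contradiction (inj (trans pl (sym pa))) λ ()
... | _      | left   | left   = contradiction (inj (trans pa (sym pr))) λ ()
... | across | right  | left   = true  , λ { left → pl ; across → pa ; right → pr }
... | right  | left   | across = false , λ { left → pl ; across → pa ; right → pr }

orientation-injective : ∀ r r′ → (∀ s → orientation r s ≡ orientation r′ s) → r ≡ r′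
orientation-injective r r′ eq = cong₂ _,_ (eq u) (eq v)

-- The orbit relation also runs `f` backwards, so being equal to `x` must be invariant in both
-- directions; injectivity gives the backward one.
fixedPoint-orbit : ∀ {A : Set} {f : A → A} → Injective _≡_ _≡_ f →
  ∀ {x} → f x ≡ x → ∀ {y} → SameOrbit f x y → x ≡ y
fixedPoint-orbit {f = f} inj {x} fx p = proj₁ (Eq.fold invariance (λ { refl → preserve , reflect }) p) refl
  where
  invariance : IsEquivalence (λ y z → (x ≡ y → x ≡ z) × (x ≡ z → x ≡ y))
  invariance = record
    { refl  = id , id
    ; sym   = swap
    ; trans = λ (p , q) (p′ , q′) → p′ ∘ p , q ∘ q′
    }
  preserve : ∀ {y} → x ≡ y → x ≡ f y
  preserve refl = sym fx
  reflect : ∀ {y} → x ≡ f y → x ≡ y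
  reflect eq = inj (trans fx eq)

module LadderRotations (k : ℕ) where
  open Ladder k

  G : Multigraph
  G = closedEndLadder (suc k)

  open RotationSystem using (next)

  toCorner-rotateDart : ∀ rs d → toCorner (rotateDart rs d) ≡ rotate rs (toCorner d)
  toCorner-rotateDart rs d = toCorner-fromCorner _

  rotateDart-fromCorner : ∀ rs c → rotateDart rs (fromCorner c) ≡ fromCorner (rotate rs c)
  rotateDart-fromCorner rs c = cong (fromCorner ∘ rotate rs) (toCorner-fromCorner c)

  rotateDart³ : ∀ rs d → rotateDart rs (rotateDart rs (rotateDart rs d)) ≡ d
  rotateDart³ rs d = begin
    rotateDart rs (rotateDart rs (rotateDart rs d))
      ≡⟨ cong (rotateDart rs) (rotateDart-fromCorner rs (rotate rs (toCorner d))) ⟩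
    rotateDart rs (fromCorner (rotate rs (rotate rs (toCorner d))))
      ≡⟨ rotateDart-fromCorner rs (rotate rs (rotate rs (toCorner d))) ⟩
    fromCorner (rotate rs (rotate rs (rotate rs (toCorner d))))
      ≡⟨ cong (λ x → fromCorner (origin d , x)) (turn³ (orientationAt rs (origin d)) (proj₂ (toCorner d))) ⟩
    fromCorner (toCorner d)
      ≡⟨ fromCorner-toCorner d ⟩
    d ∎
    where open ≡-Reasoning

  rotationSystem : Vec Rung (suc k) → RotationSystem G
  rotationSystem rs = record
    { rotation = mk↔ₛ′ (rotateDart rs) (rotateDart rs ∘ rotateDart rs) (rotateDart³ rs) (rotateDart³ rs)
    ; cyclic   = λ d d′ → mk⇔ (sameVertex d d′) sameOrbit
    }
    where
    open Setoid (Orbits (rotateDart rs)) using () renaming (trans to ∼-trans; sym to ∼-sym)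

    toLeft : ∀ d → SameOrbit (rotateDart rs) d (fromCorner (origin d , left))
    toLeft d = subst (λ e → SameOrbit (rotateDart rs) e (fromCorner (origin d , left)))
      (fromCorner-toCorner d)
      (sameOrbit-map (λ x → fromCorner (origin d , x))
        (λ x → Eq.return (rotateDart-fromCorner rs (origin d , x)))
        (turn-transitive (orientationAt rs (origin d)) (proj₂ (toCorner d))))

    sameVertex : ∀ d d′ → origin d ≡ origin d′ → SameOrbit (rotateDart rs) d d′
    sameVertex d d′ eq = ∼-trans (toLeft d)
      (subst (λ w → SameOrbit (rotateDart rs) (fromCorner (w , left)) d′) (sym eq) (∼-sym (toLeft d′)))

    sameOrbit : ∀ {d d′} → SameOrbit (rotateDart rs) d d′ → origin d ≡ origin d′
    sameOrbit = Eq.gfold isEquivalence origin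
      (λ { {d} refl → sym (cong proj₁ (toCorner-rotateDart rs d)) })

  module _ (ρ : RotationSystem G) where
    open RotationSystem ρ using (rotation; cyclic)

    private
      next-injective : Injective _≡_ _≡_ (next ρ)
      next-injective {d} {d′} eq = trans (sym (Inverse.strictlyInverseʳ rotation d))
        (trans (cong (Inverse.from rotation) eq) (Inverse.strictlyInverseʳ rotation d′))

      slotMap : Fin (suc k) × Side → Slot → Slot
      slotMap w x = proj₂ (toCorner (next ρ (fromCorner (w , x))))

      next-fromCorner : ∀ w x → next ρ (fromCorner (w , x)) ≡ fromCorner (w , slotMap w x)
      next-fromCorner w x = trans (sym (fromCorner-toCorner _)) (cong (λ w′ → fromCorner (w′ , slotMap w x))
        (trans (sym (Equivalence.from (cyclic _ _) (along 1))) (cong proj₁ (toCorner-fromCorner (w , x)))))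

      fromCorner-injective : ∀ {c c′} → fromCorner c ≡ fromCorner c′ → c ≡ c′
      fromCorner-injective eq = trans (sym (toCorner-fromCorner _))
        (trans (cong toCorner eq) (toCorner-fromCorner _))

      slotMap-injective : ∀ w → Injective _≡_ _≡_ (slotMap w)
      slotMap-injective w {x} {y} eq = cong proj₂ (fromCorner-injective (next-injective
        (trans (next-fromCorner w x) (trans (cong (λ z → fromCorner (w , z)) eq) (sym (next-fromCorner w y))))))

      -- A fixed dart would be a whole orbit, whereas `cyclic` puts the dart in another slot of the
      -- same vertex into that orbit.
      slotMap-derangement : ∀ w x → slotMap w x ≢ x
      slotMap-derangement w x eq = other≢ x (sym (cong proj₂ (fromCorner-injective
        (fixedPoint-orbit next-injective (trans (next-fromCorner w x) (cong (λ z → fromCorner (w , z)) eq))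
          (Equivalence.to (cyclic _ (fromCorner (w , turn true x)))
            (trans (cong proj₁ (toCorner-fromCorner (w , x)))
                   (sym (cong proj₁ (toCorner-fromCorner (w , turn true x))))))))))
        where
        other≢ : ∀ x → turn true x ≢ x
        other≢ left   ()
        other≢ across ()
        other≢ right  ()

      abstract
        sense : ∀ w → ∃[ b ] ∀ x → slotMap w x ≡ turn b x
        sense w = derangement⇒turn (slotMap w) (slotMap-derangement w) (slotMap-injective w)

      rungSense : Fin (suc k) → Rung
      rungSense l = proj₁ (sense (l , u)) , proj₁ (sense (l , v))

    senses : Vec Rung (suc k)
    senses = tabulate rungSense

    next-senses : ∀ d → next ρ d ≡ rotateDart senses d
    next-senses d = begin
      next ρ d                                       ≡⟨ cong (next ρ) (fromCorner-toCorner d) ⟨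
      next ρ (fromCorner (w , x))                    ≡⟨ next-fromCorner w x ⟩
      fromCorner (w , slotMap w x)                   ≡⟨ cong (λ z → fromCorner (w , z)) (proj₂ (sense w) x) ⟩
      fromCorner (w , turn (proj₁ (sense w)) x)      ≡⟨ cong (λ b → fromCorner (w , turn b x)) (orientation-senses w) ⟨
      rotateDart senses d                            ∎
      where
      open ≡-Reasoning
      w = origin d
      x = proj₂ (toCorner d)
      orientation-senses : ∀ w → orientationAt senses w ≡ proj₁ (sense w)
      orientation-senses (l , u) = cong (λ r → orientation r u) (lookup∘tabulate rungSense l)
      orientation-senses (l , v) = cong (λ r → orientation r v) (lookup∘tabulate rungSense l)

  rotateDart-injective : ∀ rs rs′ → (∀ d → rotateDart rs d ≡ rotateDart rs′ d) → rs ≡ rs′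
  rotateDart-injective rs rs′ eq = trans (sym (tabulate∘lookup rs))
    (trans (tabulate-cong (λ l → orientation-injective _ _ (λ s → turn-injective _ _ (cong proj₂ (rot l s)))))
           (tabulate∘lookup rs′))
    where
    rot : ∀ l s → rotate rs ((l , s) , left) ≡ rotate rs′ ((l , s) , left)
    rot l s = begin
      rotate rs c                          ≡⟨ toCorner-fromCorner (rotate rs c) ⟨
      toCorner (fromCorner (rotate rs c))  ≡⟨ cong toCorner (rotateDart-fromCorner rs c) ⟨
      toCorner (rotateDart rs (fromCorner c))   ≡⟨ cong toCorner (eq (fromCorner c)) ⟩
      toCorner (rotateDart rs′ (fromCorner c))  ≡⟨ cong toCorner (rotateDart-fromCorner rs′ c) ⟩
      toCorner (fromCorner (rotate rs′ c)) ≡⟨ toCorner-fromCorner (rotate rs′ c) ⟩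
      rotate rs′ c                         ∎
      where
      open ≡-Reasoning
      c = (l , s) , left

  senses-cong : ∀ ρ ρ′ → (∀ d → next ρ d ≡ next ρ′ d) → senses ρ ≡ senses ρ′
  senses-cong ρ ρ′ eq = rotateDart-injective (senses ρ) (senses ρ′)
    (λ d → trans (sym (next-senses ρ d)) (trans (eq d) (next-senses ρ′ d)))

  senses-rotationSystem : ∀ rs → senses (rotationSystem rs) ≡ rs
  senses-rotationSystem rs = rotateDart-injective (senses (rotationSystem rs)) rs
    (λ d → sym (next-senses (rotationSystem rs) d))

-- Euler's formula for the automaton.

-- The genus is charged to the rungs turning crossed into straight; each
-- of them is followed by a rung or an end undoing it.
handles : Linkage → Rung → ℕ
handles crossed  (true  , true)  = 1
handles crossed  (true  , false) = 0
handles crossed  (false , true)  = 0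
handles crossed  (false , false) = 1
handles straight r               = 0

genus : ∀ {n} → Linkage → Vec Rung n → ℕ
genus ℓ []       = 0
genus ℓ (r ∷ rs) = handles ℓ r + genus (advance ℓ r) rs

rung-euler : ∀ ℓ r → closedFaces ℓ r + 2 * handles ℓ r + endFaces (advance ℓ r) ≡ suc (endFaces ℓ)
rung-euler crossed  (true  , true)  = refl
rung-euler crossed  (true  , false) = refl
rung-euler crossed  (false , true)  = refl
rung-euler crossed  (false , false) = refl
rung-euler straight r               = refl

-- For `crossed` this is Euler's formula: with n rungs there are 2n vertices and 3n edges, and the
-- remaining 2 is `endFaces crossed`. The case `straight` serves the induction, each rung
-- contributing 1 by `rung-euler`.
euler : ∀ {n} ℓ (rs : Vec Rung n) → faces ℓ rs + 2 * genus ℓ rs ≡ n + endFaces ℓ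
euler crossed  [] = refl
euler straight [] = refl
euler {suc n} ℓ (r ∷ rs) = begin
  (c + F) + 2 * (h + g)      ≡⟨ regroup c F h g ⟩
  (c + 2 * h) + (F + 2 * g)  ≡⟨ cong (c + 2 * h +_) (euler (advance ℓ r) rs) ⟩
  (c + 2 * h) + (n + e)      ≡⟨ exchange (c + 2 * h) n e ⟩
  n + (c + 2 * h + e)        ≡⟨ cong (n +_) (rung-euler ℓ r) ⟩
  n + suc (endFaces ℓ)       ≡⟨ +-suc n (endFaces ℓ) ⟩
  suc n + endFaces ℓ         ∎
  where
  open ≡-Reasoning
  c = closedFaces ℓ r
  h = handles ℓ r
  e = endFaces (advance ℓ r)
  F = faces (advance ℓ r) rs
  g = genus (advance ℓ r) rs
  regroup : ∀ c F h g → (c + F) + 2 * (h + g) ≡ (c + 2 * h) + (F + 2 * g)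
  regroup = solve-∀
  exchange : ∀ a n e → a + (n + e) ≡ n + (a + e)
  exchange = solve-∀

-- Counting rotation systems by genus.

sumRungs : (Rung → ℕ) → ℕ
sumRungs f = (f (true , true) + f (true , false)) + (f (false , true) + f (false , false))

-- On generating functions, multiplication by the `h`-th power of the variable.
delay : ℕ → (ℕ → ℕ) → ℕ → ℕ
delay zero    f i       = f i
delay (suc h) f zero    = 0
delay (suc h) f (suc i) = delay h f i

count : Linkage → ℕ → ℕ → ℕ
count ℓ zero    zero    = 1
count ℓ zero    (suc i) = 0
count ℓ (suc n) i       = sumRungs (λ r → delay (handles ℓ r) (count (advance ℓ r) n) i)

OfGenus : Linkage → ℕ → ℕ → Set
OfGenus ℓ n i = Σ[ rs ∈ Vec Rung n ] genus ℓ rs ≡ i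

delay-↔ : ∀ {X : Set} {g : X → ℕ} {f} → (∀ i → (Σ[ x ∈ X ] g x ≡ i) ↔ Fin (f i)) →
          ∀ h i → (Σ[ x ∈ X ] h + g x ≡ i) ↔ Fin (delay h f i)
delay-↔ g↔f zero    i       = g↔f i
delay-↔ g↔f (suc h) zero    = mk↔ₛ′ (λ ()) (λ ()) (λ ()) (λ ())
delay-↔ {X} {g} g↔f (suc h) (suc i) = delay-↔ g↔f h i ↔-∘
  mk↔ₛ′ (λ (x , p) → x , suc-injective p) (λ (x , p) → x , cong suc p)
        (λ (x , p) → cong (x ,_) (≡-irrelevant _ p)) (λ (x , p) → cong (x ,_) (≡-irrelevant _ p))

firstRung-↔ : ∀ {n} {P : Vec Rung (suc n) → Set} →
  let First = λ r → Σ[ rs ∈ Vec Rung n ] P (r ∷ rs) in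
  (Σ[ rs ∈ Vec Rung (suc n) ] P rs) ↔
  ((First (true , true) ⊎ First (true , false)) ⊎ (First (false , true) ⊎ First (false , false)))
firstRung-↔ = mk↔ₛ′
  (λ { ((true  , true)  ∷ rs , p) → inj₁ (inj₁ (rs , p))
     ; ((true  , false) ∷ rs , p) → inj₁ (inj₂ (rs , p))
     ; ((false , true)  ∷ rs , p) → inj₂ (inj₁ (rs , p))
     ; ((false , false) ∷ rs , p) → inj₂ (inj₂ (rs , p)) })
  (λ { (inj₁ (inj₁ (rs , p))) → _ , p
     ; (inj₁ (inj₂ (rs , p))) → _ , p
     ; (inj₂ (inj₁ (rs , p))) → _ , p
     ; (inj₂ (inj₂ (rs , p))) → _ , p })
  (λ { (inj₁ (inj₁ _)) → refl
     ; (inj₁ (inj₂ _)) → refl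
     ; (inj₂ (inj₁ _)) → refl
     ; (inj₂ (inj₂ _)) → refl })
  (λ { ((true  , true)  ∷ rs , p) → refl
     ; ((true  , false) ∷ rs , p) → refl
     ; ((false , true)  ∷ rs , p) → refl
     ; ((false , false) ∷ rs , p) → refl })

⊎-Fin : ∀ {X Y : Set} {m n} → X ↔ Fin m → Y ↔ Fin n → (X ⊎ Y) ↔ Fin (m + n)
⊎-Fin p q = ↔-sym +↔⊎ ↔-∘ (p ⊎-↔ q)

ofGenus-↔ : ∀ ℓ n i → OfGenus ℓ n i ↔ Fin (count ℓ n i)
ofGenus-↔ ℓ zero zero = mk↔ₛ′ (λ _ → zero) (λ _ → [] , refl) (λ { zero → refl }) (λ { ([] , refl) → refl })
ofGenus-↔ ℓ zero (suc i) = mk↔ₛ′ (λ { ([] , ()) }) (λ ()) (λ ()) (λ { ([] , ()) })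
ofGenus-↔ ℓ (suc n) i =
  ⊎-Fin (⊎-Fin (tail _) (tail _)) (⊎-Fin (tail _) (tail _)) ↔-∘ firstRung-↔
  where
  tail : ∀ r → (Σ[ rs ∈ Vec Rung n ] genus ℓ (r ∷ rs) ≡ i) ↔
               Fin (delay (handles ℓ r) (count (advance ℓ r) n) i)
  tail r = delay-↔ (ofGenus-↔ (advance ℓ r) n) (handles ℓ r) i

module LadderEmbeddings (k : ℕ) where
  open Ladder k
  open LadderRotations k

  genus⇒euler : ∀ {i} (rs : Vec Rung (suc k)) → genus crossed rs ≡ i →
    suc k * 2 + faces crossed rs + 2 * i ≡ 2 * k + suc k + 2 + 2
  genus⇒euler rs refl = begin
    suc k * 2 + F + 2 * g   ≡⟨ +-assoc (suc k * 2) F (2 * g) ⟩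
    suc k * 2 + (F + 2 * g) ≡⟨ cong (suc k * 2 +_) (euler crossed rs) ⟩
    suc k * 2 + (suc k + 2) ≡⟨ ring k ⟩
    2 * k + suc k + 2 + 2   ∎
    where
    open ≡-Reasoning
    F = faces crossed rs
    g = genus crossed rs
    ring : ∀ k → suc k * 2 + (suc k + 2) ≡ 2 * k + suc k + 2 + 2
    ring = solve-∀

  euler⇒genus : ∀ {i F} (rs : Vec Rung (suc k)) → F ≡ faces crossed rs →
    suc k * 2 + F + 2 * i ≡ 2 * k + suc k + 2 + 2 → genus crossed rs ≡ i
  euler⇒genus rs refl eq = *-cancelˡ-≡ _ _ 2
    (+-cancelˡ-≡ (suc k * 2 + faces crossed rs) _ _ (trans (genus⇒euler rs refl) (sym eq)))

  embedding : ∀ i → OfGenus crossed (suc k) i → Embedding G i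
  embedding i (rs , p) = rotationSystem rs
    , faces crossed rs , HasCard-ladderFaces rs (rotateDart rs) (λ _ → refl) , genus⇒euler rs p

  ofGenus : ∀ i → Embedding G i → OfGenus crossed (suc k) i
  ofGenus i (ρ , F , card , eq) = senses ρ
    , euler⇒genus (senses ρ) (HasCard-unique {RotationSystem.Faces ρ} card
        (HasCard-ladderFaces (senses ρ) (RotationSystem.next ρ) (next-senses ρ))) eq

  OfGenus-≡ : ∀ {ℓ n i} (x y : OfGenus ℓ n i) → proj₁ x ≡ proj₁ y → x ≡ y
  OfGenus-≡ (rs , p) (_ , q) refl = cong (rs ,_) (≡-irrelevant p q)

  embeddings-card : ∀ i → HasCard (Embeddings G i) (count crossed (suc k) i)
  embeddings-card i = Compose.inverse embeddings↔ofGenus (ofGenus-↔ crossed (suc k) i)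
    where
    open RotationSystem using (next)

    ofGenus-cong : ∀ (x y : Embedding G i) →
      (∀ d → next (proj₁ x) d ≡ next (proj₁ y) d) → ofGenus i x ≡ ofGenus i y
    ofGenus-cong x y eq =
      OfGenus-≡ (ofGenus i x) (ofGenus i y) (senses-cong (proj₁ x) (proj₁ y) eq)

    ofGenus-embedding : ∀ (x : OfGenus crossed (suc k) i) → ofGenus i (embedding i x) ≡ x
    ofGenus-embedding x =
      OfGenus-≡ (ofGenus i (embedding i x)) x (senses-rotationSystem (proj₁ x))

    embeddings↔ofGenus : Inverse (Embeddings G i) (setoid (OfGenus crossed (suc k) i))
    embeddings↔ofGenus = record
      { to        = ofGenus i
      ; from      = embedding i
      ; to-cong   = λ {x} {y} → ofGenus-cong x y
      ; from-cong = λ { refl d → refl }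
      ; inverse   =
          (λ {x} {y} eq → trans (ofGenus-cong y (embedding i x) eq) (ofGenus-embedding x))
        , (λ { {x} refl d → sym (next-senses (proj₁ x) d) })
      }

-- The recurrence and the closed form.

count-zero : ∀ n → count crossed n 0 ≡ 2 ^ n
count-zero zero    = refl
count-zero (suc n) = cong₂ _+_ (count-zero n) (cong (_+ 0) (count-zero n))

-- Two choices stay in `crossed`. The other two cost one handle and lead to `straight`, from where
-- all four choices return to `crossed`: this gives 8 = 2 * 4.
count-suc : ∀ n i → count crossed (2 + n) (suc i) ≡ 2 * count crossed (1 + n) (suc i) + 8 * count crossed n i
count-suc n i = ring (count crossed (1 + n) (suc i)) (count crossed n i)
  where
  ring : ∀ x y → (((y + y) + (y + y)) + x) + (x + ((y + y) + (y + y))) ≡ 2 * x + 8 * y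
  ring = solve-∀

-- entry i d is the number of embeddings of genus i of the ladder with n
-- rungs, where n + 1 = 2 i + d; entry 0 0 has no meaning.
entry : ℕ → ℕ → ℕ
entry zero          zero    = 0
entry zero          (suc d) = 2 ^ d
entry (suc i)       zero    = 2 * 8 ^ i
entry (suc i)       (suc d) = 2 * entry (suc i) d + 8 * entry i (suc d)

count-vanishes : ∀ n i → suc n < i + i → count crossed n i ≡ 0
count-vanishes zero          (suc i)       p = refl
count-vanishes (suc zero)    (suc zero)    (s≤s (s≤s ()))
count-vanishes (suc zero)    (suc (suc i)) p = refl
count-vanishes (suc (suc n)) (suc i)       (s≤s p) = begin
  count crossed (2 + n) (suc i)                                 ≡⟨ count-suc n i ⟩
  2 * count crossed (1 + n) (suc i) + 8 * count crossed n i     ≡⟨ cong₂ (λ x y → 2 * x + 8 * y)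
                                                                    (count-vanishes (suc n) (suc i) (m<n⇒m<1+n p))
                                                                    (count-vanishes n i p′) ⟩
  0                                                             ∎
  where
  open ≡-Reasoning
  p′ : suc n < i + i
  p′ = ≤-pred (subst (3 + n ≤_) (+-suc i i) p)

count≡entry : ∀ n i d → suc n ≡ i + i + d → count crossed n i ≡ entry i d
count≡entry n zero (suc d) refl = count-zero d
count≡entry zero (suc i) d eq =
  contradiction (suc-injective eq) (λ e → 0≢1+n (trans e (cong (_+ d) (+-suc i i))))
count≡entry (suc zero) (suc zero) zero eq = refl
count≡entry (suc zero) (suc zero) (suc d) eq = contradiction (suc-injective (suc-injective eq)) λ ()
count≡entry (suc zero) (suc (suc i)) d eq =
  contradiction (suc-injective (suc-injective eq))
    (λ e → 0≢1+n (trans e (cong (_+ d) (+-suc i (suc i)))))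
count≡entry (suc (suc n)) (suc i) zero eq = helper i eq
  where
  helper : ∀ i → 3 + n ≡ suc i + suc i + zero → count crossed (2 + n) (suc i) ≡ entry (suc i) zero
  helper zero ()
  -- Here twice the genus is n + 1, the largest possible value, so the first term of the recurrence
  -- vanishes and two more rungs just multiply by 8.
  helper (suc i) eq = trans (count-suc n (suc i)) (trans (cong₂ (λ x y → 2 * x + 8 * y)
    (count-vanishes (suc n) (2 + i) (≤-reflexive (trans eq (+-identityʳ _))))
    (count≡entry n (suc i) zero
      (suc-injective (suc-injective (trans eq (cong suc (cong (_+ 0) (+-suc (suc i) (suc i)))))))))
    (ring (8 ^ i)))
    where
    ring : ∀ x → 2 * 0 + 8 * (2 * x) ≡ 2 * (8 * x)
    ring = solve-∀
count≡entry (suc (suc n)) (suc i) (suc d) eq = trans (count-suc n i) (cong₂ (λ x y → 2 * x + 8 * y)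
  (count≡entry (suc n) (suc i) d (suc-injective (trans eq (+-suc (suc i + suc i) d))))
  (count≡entry n i (suc d) (suc-injective (suc-injective (trans eq (cong (λ x → suc (x + suc d)) (+-suc i i)))))))

entry-positive : ∀ i d m → i + d ≡ suc m → 0 < entry i d
entry-positive zero          (suc d) m eq = m^n>0 2 d
entry-positive (suc i)       zero    m eq = *-mono-≤ {1} {2} (s≤s z≤n) (m^n>0 8 i)
entry-positive (suc i)       (suc d) m eq =
  ≤-trans (*-mono-≤ {1} {2} (s≤s z≤n) (entry-positive (suc i) d (i + d) refl)) (m≤m+n _ _)

-- Multiplied out, so that neither subtraction nor division occurs.
entry-closed : ∀ i d m → i + d ≡ suc m →
  4 * (entry i d * (i ! * d !)) ≡ 8 ^ i * 2 ^ d * (i + 2 * d) * m !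
entry-closed zero (suc d) .d refl = ring (2 ^ d) (d !) d
  where
  ring : ∀ t f d → 4 * (t * (1 * (suc d * f))) ≡ 1 * (2 * t) * (0 + 2 * suc d) * f
  ring = solve-∀
entry-closed (suc i) zero m eq with trans (sym (suc-injective eq)) (+-identityʳ i)
... | refl = ring (8 ^ i) (i !) i
  where
  ring : ∀ t f i → 4 * (2 * t * (suc i * f * 1)) ≡ 8 * t * 1 * (suc i + 2 * 0) * f
  ring = solve-∀
entry-closed (suc i) (suc d) m eq with trans (sym (suc-injective eq)) (+-suc i d)
... | refl = begin
  -- Both entries have index sum i + d + 1 and hence the same factorial `(i + d) !` in their closed
  -- forms; the factors `suc d` and `suc i` complete the denominators.
  4 * ((2 * b₁ + 8 * b₂) * (suc i * i ! * (suc d * d !)))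
    ≡⟨ ring₁ b₁ b₂ (i !) (d !) i d ⟩
  2 * suc d * (4 * (b₁ * (suc i * i ! * d !))) + 8 * suc i * (4 * (b₂ * (i ! * (suc d * d !))))
    ≡⟨ cong₂ (λ x y → 2 * suc d * x + 8 * suc i * y)
             (entry-closed (suc i) d (i + d) refl) (entry-closed i (suc d) (i + d) (+-suc i d)) ⟩
  2 * suc d * (8 * 8 ^ i * 2 ^ d * (suc i + 2 * d) * (i + d) !) +
  8 * suc i * (8 ^ i * (2 * 2 ^ d) * (i + 2 * suc d) * (i + d) !)
    ≡⟨ ring₂ (8 ^ i) (2 ^ d) ((i + d) !) i d ⟩
  8 * 8 ^ i * (2 * 2 ^ d) * (suc i + 2 * suc d) * (suc (i + d) * (i + d) !) ∎
  where
  open ≡-Reasoning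
  b₁ = entry (suc i) d
  b₂ = entry i (suc d)
  ring₁ : ∀ b₁ b₂ p q i d → 4 * ((2 * b₁ + 8 * b₂) * (suc i * p * (suc d * q))) ≡
    2 * suc d * (4 * (b₁ * (suc i * p * q))) + 8 * suc i * (4 * (b₂ * (p * (suc d * q))))
  ring₁ = solve-∀
  ring₂ : ∀ s t f i d → 2 * suc d * (8 * s * t * (suc i + 2 * d) * f) + 8 * suc i * (s * (2 * t) * (i + 2 * suc d) * f) ≡
    8 * s * (2 * t) * (suc i + 2 * suc d) * (suc (i + d) * f)
  ring₂ = solve-∀

-- Ratios of consecutive entries.

-- up i d / down i d is the ratio of the numbers of embeddings of genus
-- 1 + i and i when n + 1 = 2 (1 + i) + d.
down up : ℕ → ℕ → ℕ
down i d = suc i * suc (i + d) * (4 + (i + 2 * d))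
up   i d = 2 * suc (i + 2 * d) * suc d * (2 + d)

entry-ratio : ∀ i d → entry (suc i) d * down i d ≡ entry i (2 + d) * up i d
-- One 4 and `q` build the left side of `entry-closed`; the other 4 balances the powers `2 ^ d` and
-- `2 ^ (2 + d)` in the two closed forms.
entry-ratio i d = *-cancelʳ-≡ _ _ (4 * 4 * q) {{nz}} (begin
  b′ * down i d * (4 * 4 * q)              ≡⟨ ring₁ b′ (i !) (d !) i d ⟩
  (4 * (b′ * (suc i * i ! * d !))) * (4 * (i + 2 * (2 + d)) * suc (i + d))
    ≡⟨ cong (_* (4 * (i + 2 * (2 + d)) * suc (i + d))) (entry-closed (suc i) d (i + d) refl) ⟩
  (8 * 8 ^ i * 2 ^ d * (suc i + 2 * d) * f) * (4 * (i + 2 * (2 + d)) * suc (i + d))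
    ≡⟨ ring₂ (8 ^ i) (2 ^ d) f i d ⟩
  (8 ^ i * (2 * (2 * 2 ^ d)) * (i + 2 * (2 + d)) * (suc (i + d) * f)) * (8 * suc (i + 2 * d))
    ≡⟨ cong (_* (8 * suc (i + 2 * d))) (entry-closed i (2 + d) (suc (i + d))
         (trans (+-suc i (suc d)) (cong suc (+-suc i d)))) ⟨
  (4 * (b * (i ! * ((2 + d) * (suc d * d !))))) * (8 * suc (i + 2 * d))
    ≡⟨ ring₃ b (i !) (d !) i d ⟩
  b * up i d * (4 * 4 * q)                 ∎)
  where
  open ≡-Reasoning
  b  = entry i (2 + d)
  b′ = entry (suc i) d
  q  = i ! * d !
  f  = (i + d) !
  nz : NonZero (4 * 4 * q)
  nz = m*n≢0 (4 * 4) q {{_}} {{i !* d !≢0}}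
  ring₁ : ∀ b′ p q i d → b′ * (suc i * suc (i + d) * (4 + (i + 2 * d))) * (4 * 4 * (p * q)) ≡
    (4 * (b′ * (suc i * p * q))) * (4 * (i + 2 * (2 + d)) * suc (i + d))
  ring₁ = solve-∀
  ring₂ : ∀ x y f i d →
    (8 * x * y * (suc i + 2 * d) * f) * (4 * (i + 2 * (2 + d)) * suc (i + d)) ≡
    (x * (2 * (2 * y)) * (i + 2 * (2 + d)) * (suc (i + d) * f)) * (8 * suc (i + 2 * d))
  ring₂ = solve-∀
  ring₃ : ∀ b p q i d →
    (4 * (b * (p * ((2 + d) * (suc d * q))))) * (8 * suc (i + 2 * d)) ≡
    b * (2 * suc (i + 2 * d) * suc d * (2 + d)) * (4 * 4 * (p * q))
  ring₃ = solve-∀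

-- Once d is written as i + e, the difference is a polynomial with nonnegative coefficients, linear
-- part 3 i + 8 e and no constant term. It vanishes for i = e = 0, the ladder with one rung, which
-- has as many embeddings of genus 0 as of genus 1.
down<up : ∀ i e → 0 < i + e → down i (i + e) < up i (i + e)
down<up i e pos = begin-strict
  down i (i + e)                                 ≡⟨ +-identityʳ (down i (i + e)) ⟨
  down i (i + e) + 0                             <⟨ +-monoʳ-< (down i (i + e)) (≤-trans pos (m≤m+n (i + e) rest)) ⟩
  down i (i + e) + (i + e + rest)                ≡⟨ ring i e ⟩
  up i (i + e)                                   ∎
  where
  open ≤-Reasoning
  rest = 9 * (i * i * e) + 3 * (i * i) + 12 * (i * e * e) +
         21 * (i * e) + 2 * i + 4 * (e * e * e) + 12 * (e * e) + 7 * e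
  ring : ∀ i e → suc i * suc (i + (i + e)) * (4 + (i + 2 * (i + e))) +
    (i + e + (9 * (i * i * e) + 3 * (i * i) + 12 * (i * e * e) +
              21 * (i * e) + 2 * i + 4 * (e * e * e) + 12 * (e * e) + 7 * e))
    ≡ 2 * suc (i + 2 * (i + e)) * suc (i + e) * (2 + (i + e))
  ring = solve-∀

-- Once i is written as 1 + d + e, the difference has nonnegative coefficients and constant term 12.
up<down : ∀ d e → up (suc (d + e)) d < down (suc (d + e)) d
up<down d e = ≤-trans (s≤s (m≤m+n (up (suc (d + e)) d) rest)) (≤-reflexive (ring d e))
  where
  rest = 6 * (d * d) + 9 * (d * d * e) + 18 * d + 27 * (d * e) + 6 * (d * e * e) + 11 + 20 * e + 9 * (e * e) + e * e * e
  ring : ∀ d e → suc (2 * suc (suc (d + e) + 2 * d) * suc d * (2 + d) +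
    (6 * (d * d) + 9 * (d * d * e) + 18 * d + 27 * (d * e) + 6 * (d * e * e) + 11 + 20 * e + 9 * (e * e) + e * e * e))
    ≡ suc (suc (d + e)) * suc (suc (d + e) + d) * (4 + (suc (d + e) + 2 * d))
  ring = solve-∀

-- factor-wise comparison, after (i + 2 d + 5)² ≥ (i + 2 d + 2) (i + 2 d + 8)
down*up≤up*down : ∀ i d → down i (2 + d) * up (suc i) d ≤ up i (2 + d) * down (suc i) d
down*up≤up*down i d = begin
  down i (2 + d) * up (suc i) d                 ≡⟨ ring₁ i d ⟩
  2 * ((i + 2 * d + 2) * (i + 2 * d + 8)) * (suc d * (2 + d)) * (suc i * (i + d + 3))
    ≤⟨ *-mono-≤ (*-mono-≤ (*-monoʳ-≤ 2 (≤-trans (m≤m+n _ 9) (≤-reflexive (ring₂ i d))))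
                          (*-mono-≤ (m≤n+m (suc d) 2) (m≤n+m (2 + d) 2)))
                (≤-trans (m≤m+n _ (1 + d)) (≤-reflexive (ring₃ i d))) ⟩
  2 * ((i + 2 * d + 5) * (i + 2 * d + 5)) * ((3 + d) * (4 + d)) * ((2 + i) * (i + d + 2))
    ≡⟨ ring₄ i d ⟩
  up i (2 + d) * down (suc i) d                 ∎
  where
  open ≤-Reasoning
  ring₁ : ∀ i d → suc i * suc (i + (2 + d)) * (4 + (i + 2 * (2 + d))) * (2 * suc (suc i + 2 * d) * suc d * (2 + d)) ≡
    2 * ((i + 2 * d + 2) * (i + 2 * d + 8)) * (suc d * (2 + d)) * (suc i * (i + d + 3))
  ring₁ = solve-∀
  ring₂ : ∀ i d → (i + 2 * d + 2) * (i + 2 * d + 8) + 9 ≡ (i + 2 * d + 5) * (i + 2 * d + 5)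
  ring₂ = solve-∀
  ring₃ : ∀ i d → suc i * (i + d + 3) + (1 + d) ≡ (2 + i) * (i + d + 2)
  ring₃ = solve-∀
  ring₄ : ∀ i d → 2 * ((i + 2 * d + 5) * (i + 2 * d + 5)) * ((3 + d) * (4 + d)) * ((2 + i) * (i + d + 2)) ≡
    2 * suc (i + 2 * (2 + d)) * suc (2 + d) * (2 + (2 + d)) * (suc (suc i) * suc (suc i + d) * (4 + (suc i + 2 * d)))
  ring₄ = solve-∀

-- The ratio of neighbours decreases by `down*up≤up*down`; multiplying by one numerator and one
-- denominator turns both outer entries into multiples of the middle one.
entry-logConcave : ∀ i d → entry i (4 + d) * entry (2 + i) d ≤ entry (1 + i) (2 + d) * entry (1 + i) (2 + d)
entry-logConcave i d = *-cancelʳ-≤ _ _ (up i (2 + d) * down (suc i) d) (begin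
  (b₀ * b₂) * (up i (2 + d) * down (suc i) d)   ≡⟨ interchange b₀ b₂ _ _ ⟩
  (b₀ * up i (2 + d)) * (b₂ * down (suc i) d)   ≡⟨ cong₂ _*_ (sym (entry-ratio i (2 + d))) (entry-ratio (suc i) d) ⟩
  (b₁ * down i (2 + d)) * (b₁ * up (suc i) d)   ≡⟨ interchange b₁ (down i (2 + d)) b₁ _ ⟩
  (b₁ * b₁) * (down i (2 + d) * up (suc i) d)   ≤⟨ *-monoʳ-≤ (b₁ * b₁) (down*up≤up*down i d) ⟩
  (b₁ * b₁) * (up i (2 + d) * down (suc i) d)   ∎)
  where
  open ≤-Reasoning
  b₀ = entry i (4 + d)
  b₁ = entry (1 + i) (2 + d)
  b₂ = entry (2 + i) d
  interchange : ∀ a b c d → (a * b) * (c * d) ≡ (a * c) * (b * d)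
  interchange = solve-∀

private
  proportional-< : ∀ {a b p q} → 0 < a → b * p ≡ a * q → p < q → a < b
  proportional-< {a} {b} {p} {q} 0<a eq p<q = *-cancelʳ-< p a b
    (≤-trans (*-monoʳ-< a {{>-nonZero 0<a}} p<q) (≤-reflexive (sym eq)))

entry-increases : ∀ i d → i ≤ d → 0 < d → entry i (2 + d) < entry (suc i) d
entry-increases i d i≤d 0<d with m≤n⇒∃[o]m+o≡n i≤d
... | e , refl = proportional-< (entry-positive i (2 + d) (i + suc d) (+-suc i (suc d)))
                                (entry-ratio i d) (down<up i e 0<d)

entry-decreases : ∀ i d → d < i → entry (suc i) d < entry i (2 + d)
entry-decreases i d d<i with m≤n⇒∃[o]m+o≡n d<i
... | e , refl = proportional-< (entry-positive (suc i) d (i + d) refl)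
                                (sym (entry-ratio i d)) (up<down d e)

-- Growth and decline in terms of the number of rungs.

count-positive : ∀ n i → i + i ≤ suc n → 0 < count crossed n i
count-positive n i 2i≤ with m≤n⇒∃[o]m+o≡n 2i≤
... | d , eq = subst (0 <_) (sym (count≡entry n i d (sym eq))) (positive i d eq)
  where
  positive : ∀ i d → i + i + d ≡ suc n → 0 < entry i d
  positive zero    (suc d) _ = entry-positive 0 (suc d) d refl
  positive (suc i) d       _ = entry-positive (suc i) d (i + d) refl

neighbour-index : ∀ i d → suc i + suc i + d ≡ i + i + (2 + d)
neighbour-index = solve-∀

triple : ∀ i → suc i * 3 ≡ suc i + suc i + i + 1
triple = solve-∀

-- With n + 1 = 2 (i + 1) + d, the bound on 3 (i + 1) says exactly that i ≤ d, which is the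
-- threshold of `entry-increases`.
count-increases : ∀ n i → 2 ≤ n → suc i * 3 ≤ n + 2 → count crossed n i < count crossed n (suc i)
count-increases n i 2≤n 3i+3≤n+2 with m≤n⇒∃[o]m+o≡n (≤-trans (m≤m+n (suc i + suc i) i) 3i+2≤n+1)
  where
  3i+2≤n+1 : suc i + suc i + i ≤ suc n
  3i+2≤n+1 = +-cancelʳ-≤ 1 _ _ (subst₂ _≤_ (triple i) (+-suc n 1) 3i+3≤n+2)
... | d , eq = subst₂ _<_
  (sym (count≡entry n i (2 + d) (trans (sym eq) (neighbour-index i d))))
  (sym (count≡entry n (suc i) d (sym eq)))
  (entry-increases i d i≤d (0<d i d i≤d eq))
  where
  i≤d : i ≤ d
  i≤d = +-cancelˡ-≤ (suc i + suc i) _ _ (≤-trans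
    (+-cancelʳ-≤ 1 _ _ (subst₂ _≤_ (triple i) (+-suc n 1) 3i+3≤n+2)) (≤-reflexive (sym eq)))
  0<d : ∀ i d → i ≤ d → suc i + suc i + d ≡ suc n → 0 < d
  0<d i       (suc d) _ _    = s≤s z≤n
  -- d = 0 forces i = 0 and then n = 1, the case of equal neighbours.
  0<d zero    zero    _ refl = contradiction 2≤n λ { (s≤s ()) }

count-decreases : ∀ n i → n + 2 < suc i * 3 → suc i + suc i ≤ suc n → count crossed n (suc i) < count crossed n i
count-decreases n i n+2<3i+3 2i+2≤n+1 with m≤n⇒∃[o]m+o≡n 2i+2≤n+1
... | d , eq = subst₂ _<_
  (sym (count≡entry n (suc i) d (sym eq)))
  (sym (count≡entry n i (2 + d) (trans (sym eq) (neighbour-index i d))))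
  (entry-decreases i d (+-cancelˡ-< (suc i + suc i) _ _ (subst (_< suc i + suc i + i) (sym eq)
    (+-cancelʳ-< 1 _ _ (subst₂ _<_ (+-suc n 1) (triple i) n+2<3i+3)))))

count-logConcave : ∀ n i → count crossed n i * count crossed n (2 + i) ≤
                           count crossed n (1 + i) * count crossed n (1 + i)
count-logConcave n i with (2 + i) + (2 + i) ≤? suc n
... | no 2i+4≰n+1 = ≤-trans
  (≤-reflexive (trans (cong (count crossed n i *_) (count-vanishes n (2 + i) (≰⇒> 2i+4≰n+1)))
                      (*-zeroʳ (count crossed n i))))
  z≤n
... | yes 2i+4≤n+1 with m≤n⇒∃[o]m+o≡n 2i+4≤n+1
... | d , eq = subst₂ _≤_
  (sym (cong₂ _*_ (count≡entry n i (4 + d) eq₀) (count≡entry n (2 + i) d (sym eq))))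
  (sym (cong₂ _*_ (count≡entry n (1 + i) (2 + d) eq₁) (count≡entry n (1 + i) (2 + d) eq₁)))
  (entry-logConcave i d)
  where
  eq₁ : suc n ≡ suc i + suc i + (2 + d)
  eq₁ = trans (sym eq) (neighbour-index (suc i) d)
  eq₀ : suc n ≡ i + i + (4 + d)
  eq₀ = trans eq₁ (neighbour-index i (2 + d))

-- The range of genera and the peak.

HasCard⇒positive : ∀ {S m} → HasCard S m → Setoid.Carrier S → 0 < m
HasCard⇒positive {m = suc m} card x = s≤s z≤n
HasCard⇒positive {m = zero}  card x with () ← Inverse.to card x

*2≡+ : ∀ m → m * 2 ≡ m + m
*2≡+ = solve-∀

module _ (k : ℕ) where
  open LadderRotations k using (G)
  open LadderEmbeddings k using (embeddings-card)

  embed : ∀ i → i + i ≤ suc (suc k) → Embedding G i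
  embed i 2i≤ = Inverse.from (embeddings-card i) (fromℕ< (count-positive (suc k) i 2i≤))

  embedding⇒2i≤n+1 : ∀ i → Embedding G i → i + i ≤ suc (suc k)
  embedding⇒2i≤n+1 i e with i + i ≤? suc (suc k)
  ... | yes p = p
  ... | no ¬p = contradiction
    (subst (0 <_) (count-vanishes (suc k) i (≰⇒> ¬p)) (HasCard⇒positive (embeddings-card i) e)) λ ()

  genusDistribution : GenusDistribution G
  genusDistribution = record
    { g          = count crossed (suc k)
    ; g-card     = embeddings-card
    ; γ          = 0
    ; γ-attains  = embed 0 z≤n
    ; γ-minimum  = λ _ _ → z≤n
    ; γM         = (2 + k) / 2
    ; γM-attains = embed ((2 + k) / 2)
        (subst (_≤ 2 + k) (*2≡+ ((2 + k) / 2)) (m/n*n≤m (2 + k) 2))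
    ; γM-maximum = λ i e → subst (_≤ (2 + k) / 2) (m*n/n≡m i 2)
        (/-monoˡ-≤ 2 (subst (_≤ 2 + k) (sym (*2≡+ i)) (embedding⇒2i≤n+1 i e)))
    }

  module _ (D : GenusDistribution G) where
    open GenusDistribution D

    g≡count : ∀ i → g i ≡ count crossed (suc k) i
    g≡count i = HasCard-unique (g-card i) (embeddings-card i)

    logConcave : LogConcave g γ γM
    logConcave i _ _ = subst₂ _≤_
      (sym (cong₂ _*_ (g≡count i) (g≡count (2 + i))))
      (sym (cong₂ _*_ (g≡count (1 + i)) (g≡count (1 + i))))
      (count-logConcave (suc k) i)

    private
      p : ℕ
      p = (suc k + 2) / 3

      increases : ∀ i → 2 ≤ suc k → i < p → g i < g (suc i)
      increases i 2≤n i<p = subst₂ _<_ (sym (g≡count i)) (sym (g≡count (suc i)))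
        (count-increases (suc k) i 2≤n (≤-trans (*-monoˡ-≤ 3 i<p) (m/n*n≤m (suc k + 2) 3)))

      n+2<3i+3 : ∀ i → p ≤ i → suc k + 2 < suc i * 3
      n+2<3i+3 i p≤i = begin-strict
        suc k + 2                    ≡⟨ m≡m%n+[m/n]*n (suc k + 2) 3 ⟩
        (suc k + 2) % 3 + p * 3      <⟨ +-monoˡ-< (p * 3) (m%n<n (suc k + 2) 3) ⟩
        suc p * 3                    ≤⟨ *-monoˡ-≤ 3 (s≤s p≤i) ⟩
        suc i * 3                    ∎
        where open ≤-Reasoning

      decreases : ∀ i → p ≤ i → suc i + suc i ≤ 2 + k → g (suc i) < g i
      decreases i p≤i 2i+2≤n+1 = subst₂ _<_ (sym (g≡count (suc i))) (sym (g≡count i))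
        (count-decreases (suc k) i (n+2<3i+3 i p≤i) 2i+2≤n+1)

      -- Places the peak within the range of genera: 2 p ≤ 3 p - 1 ≤ n + 1 as soon as p is positive.
      2p≤n+1 : p + p ≤ 2 + k
      2p≤n+1 = bound p (m/n*n≤m (suc k + 2) 3)
        where
        bound : ∀ q → q * 3 ≤ suc k + 2 → q + q ≤ 2 + k
        bound zero    _    = z≤n
        bound (suc q) 3q+3≤n+2 = ≤-trans (m≤m+n (suc q + suc q) q)
          (+-cancelʳ-≤ 1 _ _ (subst₂ _≤_ (triple q) (+-suc (suc k) 1) 3q+3≤n+2))

    peak : 2 ≤ suc k → IsPeak g γ γM p
    peak 2≤n = record
      { q≤l     = ≤-trans (γ-minimum 0 (embed 0 z≤n)) z≤n
      ; l≤m     = ≤-refl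
      ; m≤r     = γM-maximum p (embed p 2p≤n+1)
      ; rising  = λ i _ i+1<p → <⇒≤ (increases i 2≤n (<-trans (n<1+n i) i+1<p))
      ; jump    = λ i _ i+1≡p → subst (λ l → g i < g l) i+1≡p (increases i 2≤n (≤-reflexive i+1≡p))
      ; plateau = λ i p≤i i<p → contradiction i<p (≤⇒≯ p≤i)
      ; drop    = λ p<r → decreases p ≤-refl (bounded p<r)
      ; falling = λ i p<i i<r → <⇒≤ (decreases i (<⇒≤ p<i) (bounded i<r))
      }
      where
      bounded : ∀ {i} → i ≤ γM → i + i ≤ 2 + k
      bounded i≤γM = ≤-trans (+-mono-≤ i≤γM i≤γM) (embedding⇒2i≤n+1 γM γM-attains)

corollary4p5 : (n : ℕ) .{{_ : NonZero n}} →
    GenusDistribution (closedEndLadder n) ×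
    ((D : GenusDistribution (closedEndLadder n)) →
    let open GenusDistribution D in
    LogConcave g γ γM × (2 ≤ n → IsPeak g γ γM ((n + 2) / 3)))
corollary4p5 (suc k) = genusDistribution k , λ D → logConcave k D , peak k D
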